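{- Let $n\in\mathbb{N}$, $n>1$, let $d$ be a pseudometric on $D_n$, and let $\preceq_d$ be the preorder on $D_n$ induced by $d$. Let $M$ be a set with $D_n\subseteq M\subseteq\mathbb{Z}$. Then the relation $\preceq^*_d$ on $M$ defined by $$x\preceq^*_d y\iff \gcd(x,n)\preceq_d\gcd(y,n)\qquad(x,y\in M)$$ is a preorder on $M$.
   Context: $\mathbb{N}$ is the set of positive integers and $D_n=\{x\in\mathbb{N}: x\mid n\}$. A pseudometric on a set $S$ is a function $d:S\times S\to\mathbb{R}$ with $d(x,x)=0$, $d(x,y)=d(y,x)$ and $d(x,z)\le d(x,y)+d(y,z)$ for all $x,y,z\in S$. For a set $S$ of integers containing $1$ and a pseudometric $d$ on $S$, the preorder induced by $d$ is $x\preceq_d y\iff d(1,x)\le d(1,y)$. A preorder is a reflexive and transitive relation. -}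

module Defs where

open import Data.Integer.Base using (ℤ; +_; 0ℤ; 1ℤ; ∣_∣; +<+)
  renaming (_<_ to _<ℤ_)
open import Data.Integer.Divisibility using (_∣_)
open import Data.Integer.GCD using (gcd; gcd[i,j]∣j)
open import Data.Irrelevant using ([_])
open import Data.Nat.Base as ℕ using (ℕ; _⊔_; z<s)
import Data.Nat.Divisibility as ℕ
import Data.Nat.GCD as ℕ
import Data.Nat.Properties as ℕ
open import Data.Product.Base using (∃-syntax; _×_; _,_)
open import Data.Rational.Base as ℚ using (ℚ; 0ℚ; ½; _<_; _≤_; _+_; _-_; _*_)
  renaming (∣_∣ to ∣_∣ℚ)
import Data.Rational.Properties as ℚ
open import Data.Rational.Solver using (module +-*-Solver)
open import Data.Refinement.Base using (Refinement; value; _,_)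
open import Data.Sum.Base using (inj₂)
open import Function.Metric.Core using (DistanceFunction)
open import Function.Metric.Definitions using (Symmetric; TriangleInequality)
open import Level using (Level)
open import Relation.Binary.Core using (Rel)
open import Relation.Binary.PropositionalEquality
  using (_≡_; refl; cong; subst; subst₂)
open import Relation.Unary using (Pred; _∈_)

private
  variable
    a ℓ : Level

-- The real numbers are Cauchy sequences of rationals, under the setoid
-- equality _≃ᴿ_ below.

IsCauchy : (ℕ → ℚ) → Set
IsCauchy x = ∀ ε → 0ℚ < ε →
  ∃[ N ] (∀ i j → N ℕ.≤ i → N ℕ.≤ j → ∣ x i - x j ∣ℚ < ε)

record ℝ : Set where
  constructor mkℝ
  field
    seq    : ℕ → ℚ
    cauchy : IsCauchy seq

open ℝ public

infix 4 _≃ᴿ_ _≤ᴿ_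

_≃ᴿ_ : Rel ℝ _
x ≃ᴿ y = ∀ ε → 0ℚ < ε →
  ∃[ N ] (∀ i → N ℕ.≤ i → ∣ seq x i - seq y i ∣ℚ < ε)

-- Not termwise: x ≤ᴿ y says that, for every ε > 0, the inequality
-- xᵢ ≤ yᵢ + ε holds eventually, so that _≤ᴿ_ respects _≃ᴿ_.
_≤ᴿ_ : Rel ℝ _
x ≤ᴿ y = ∀ ε → 0ℚ < ε →
  ∃[ N ] (∀ i → N ℕ.≤ i → seq x i ≤ seq y i + ε)

0ᴿ : ℝ
0ᴿ = mkℝ (λ _ → 0ℚ) (λ ε 0<ε → 0 , λ _ _ _ _ → 0<ε)

private
  0<½*ε : ∀ ε → 0ℚ < ε → 0ℚ < ½ * ε
  0<½*ε ε 0<ε = subst (_< ½ * ε) (ℚ.*-zeroʳ ½) (ℚ.*-monoʳ-<-pos ½ 0<ε)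

  halves : ∀ ε → ½ * ε + ½ * ε ≡ ε
  halves = solve 1 (λ ε → con ½ :* ε :+ con ½ :* ε := ε) refl
    where open +-*-Solver

  interchange : ∀ p q r s → (p - r) + (q - s) ≡ (p + q) - (r + s)
  interchange = solve 4
    (λ p q r s → (p :- r) :+ (q :- s) := (p :+ q) :- (r :+ s)) refl
    where open +-*-Solver

  +-cauchy : ∀ x y → IsCauchy x → IsCauchy y → IsCauchy (λ i → x i + y i)
  +-cauchy x y cx cy ε 0<ε
    with M , p ← cx (½ * ε) (0<½*ε ε 0<ε)
       | N , q ← cy (½ * ε) (0<½*ε ε 0<ε)
    = M ⊔ N , λ i j M⊔N≤i M⊔N≤j →
      subst₂ _<_ (cong ∣_∣ℚ (interchange (x i) (y i) (x j) (y j))) (halves ε)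
        (ℚ.≤-<-trans (ℚ.∣p+q∣≤∣p∣+∣q∣ (x i - x j) (y i - y j))
          (ℚ.+-mono-<
            (p i j (ℕ.m⊔n≤o⇒m≤o M N M⊔N≤i) (ℕ.m⊔n≤o⇒m≤o M N M⊔N≤j))
            (q i j (ℕ.m⊔n≤o⇒n≤o M N M⊔N≤i) (ℕ.m⊔n≤o⇒n≤o M N M⊔N≤j))))

infixl 6 _+ᴿ_

_+ᴿ_ : ℝ → ℝ → ℝ
x +ᴿ y = mkℝ (λ i → seq x i + seq y i)
  (+-cauchy (seq x) (seq y) (cauchy x) (cauchy y))

-- The library's metric structures build in nonnegativity of the distance,
-- which is not an axiom here, so only its definitions are reused.
record IsPseudometric {S : Set a} (d : DistanceFunction S ℝ) : Set a where
  field
    d[x,x]≃0 : ∀ x → d x x ≃ᴿ 0ᴿ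
    d-sym    : Symmetric _≃ᴿ_ d
    triangle : TriangleInequality _≤ᴿ_ _+ᴿ_ d

-- The elements of a set of integers. Membership proofs are irrelevant, so
-- _≡_ on ⟨ S ⟩ is equality of the underlying integers, and a function out
-- of ⟨ S ⟩ depends on the integer alone.
⟨_⟩ : Pred ℤ ℓ → Set ℓ
⟨ S ⟩ = Refinement ℤ S

InducedPreorder : {S : Pred ℤ ℓ} → 1ℤ ∈ S → DistanceFunction ⟨ S ⟩ ℝ →
                  Rel ⟨ S ⟩ _
InducedPreorder 1∈S d x y =
  d (1ℤ , [ 1∈S ]) x ≤ᴿ d (1ℤ , [ 1∈S ]) y

D : ℕ → Pred ℤ _
D n x = 0ℤ <ℤ x × x ∣ + n

1∈D : ∀ n → 1ℤ ∈ D n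
1∈D n = +<+ z<s , ℕ.1∣ n

gcd∈D : ∀ {n} → 1 ℕ.< n → ∀ x → gcd x (+ n) ∈ D n
gcd∈D {n} 1<n x =
  +<+ (ℕ.n≢0⇒n>0 (ℕ.gcd[m,n]≢0 ∣ x ∣ n (inj₂ (ℕ.m<n⇒n≢0 1<n)))) ,
  gcd[i,j]∣j x (+ n)

gcdD : ∀ {n} → 1 ℕ.< n → ℤ → ⟨ D n ⟩
gcdD {n} 1<n x = gcd x (+ n) , [ gcd∈D 1<n x ]

GcdPreorder : ∀ {n} → 1 ℕ.< n → DistanceFunction ⟨ D n ⟩ ℝ →
              (M : Pred ℤ ℓ) → Rel ⟨ M ⟩ _
GcdPreorder {n = n} 1<n d M x y =
  InducedPreorder (1∈D n) d (gcdD 1<n (value x)) (gcdD 1<n (value y))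

{-# OPTIONS --safe #-}
module Submission where

open import Defs
open import Data.Integer.Base using (ℤ)
open import Data.Nat.Base using (ℕ; _<_; _⊔_)
import Data.Nat.Properties as ℕ
open import Data.Product.Base using (_,_)
open import Data.Rational.Base as ℚ using (0ℚ; ½)
import Data.Rational.Properties as ℚ
open import Data.Rational.Solver using (module +-*-Solver)
open import Data.Refinement.Base using (value)
open import Function.Metric.Core using (DistanceFunction)
open import Relation.Binary.Definitions using (Reflexive; Transitive)
open import Relation.Binary.PropositionalEquality using (_≡_; refl; subst)
open import Relation.Binary.PropositionalEquality.Properties using (isEquivalence)
open import Relation.Binary.Structures using (IsPreorder)
open import Relation.Unary using (Pred; _⊆_)

-- Reflexivity and transitivity survive pulling a relation back along a function. The relation on
-- `M` is `_≤ᴿ_` pulled back along `x ↦ d(1, gcd(x, n))`, in two stages: along `d(1, ·)` to `D n`,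
-- then along `gcd(·, n)` to `M`. The analytic content is thus `≤ᴿ-refl` and `≤ᴿ-trans`.

≤ᴿ-refl : Reflexive _≤ᴿ_
≤ᴿ-refl {x} ε 0<ε = 0 , λ i _ →
  subst (ℚ._≤ seq x i ℚ.+ ε) (ℚ.+-identityʳ (seq x i))
    (ℚ.+-monoʳ-≤ (seq x i) (ℚ.<⇒≤ 0<ε))

0<½*ε : ∀ {ε} → 0ℚ ℚ.< ε → 0ℚ ℚ.< ½ ℚ.* ε
0<½*ε {ε} 0<ε = subst (ℚ._< ½ ℚ.* ε) (ℚ.*-zeroʳ ½) (ℚ.*-monoʳ-<-pos ½ 0<ε)

p+½*ε+½*ε≡p+ε : ∀ p ε → p ℚ.+ ½ ℚ.* ε ℚ.+ ½ ℚ.* ε ≡ p ℚ.+ ε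
p+½*ε+½*ε≡p+ε = solve 2
  (λ p ε → p :+ con ½ :* ε :+ con ½ :* ε := p :+ ε) refl
  where open +-*-Solver

-- The slack `ε` is split evenly between the two hypotheses; past the larger of their thresholds
-- both estimates hold and the two halves add up to `ε`.
≤ᴿ-trans : Transitive _≤ᴿ_
≤ᴿ-trans {x} {y} {z} x≤y y≤z ε 0<ε
  with M , p ← x≤y (½ ℚ.* ε) (0<½*ε 0<ε)
     | N , q ← y≤z (½ ℚ.* ε) (0<½*ε 0<ε)
  = M ⊔ N , λ i M⊔N≤i → begin
    seq x i                             ≤⟨ p i (ℕ.m⊔n≤o⇒m≤o M N M⊔N≤i) ⟩
    seq y i ℚ.+ ½ ℚ.* ε                 ≤⟨ ℚ.+-monoˡ-≤ (½ ℚ.* ε) (q i (ℕ.m⊔n≤o⇒n≤o M N M⊔N≤i)) ⟩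
    seq z i ℚ.+ ½ ℚ.* ε ℚ.+ ½ ℚ.* ε     ≡⟨ p+½*ε+½*ε≡p+ε (seq z i) ε ⟩
    seq z i ℚ.+ ε                       ∎
  where open ℚ.≤-Reasoning

inducedPreorder-isPreorder :
  ∀ {ℓ} {S : Pred ℤ ℓ} 1∈S (d : DistanceFunction ⟨ S ⟩ ℝ) →
  IsPreorder _≡_ (InducedPreorder {S = S} 1∈S d)
inducedPreorder-isPreorder 1∈S d = record
  { isEquivalence = isEquivalence
  -- The reals are passed explicitly: `_≤ᴿ_` unfolds to a statement about `seq` alone, which does
  -- not determine the `cauchy` component.
  ; reflexive     = λ { {x} refl → ≤ᴿ-refl {d _ x} }
  ; trans         = λ {x} {y} {z} → ≤ᴿ-trans {d _ x} {d _ y} {d _ z}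
  }

lemma1p7 : ∀ {ℓ} (n : ℕ) (1<n : 1 < n) →
    (d : DistanceFunction ⟨ D n ⟩ ℝ) → IsPseudometric d →
    (M : Pred ℤ ℓ) → D n ⊆ M →
    IsPreorder _≡_ (GcdPreorder 1<n d M)
lemma1p7 n 1<n d _ M _ = record
  { isEquivalence = isEquivalence
  -- Each law on `M` is the law on `D n` at the gcds, which are positive divisors of `n` and so lie
  -- in `D n`.
  ; reflexive     = λ { {x} refl → ⪯.refl {gcdD 1<n (value x)} }
  ; trans         = λ {x} {y} {z} →
      ⪯.trans {gcdD 1<n (value x)} {gcdD 1<n (value y)} {gcdD 1<n (value z)}
  }
  where module ⪯ = IsPreorder (inducedPreorder-isPreorder (1∈D n) d)
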